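{- Let $W$ be a normal PO-dilator, $X$ a partial order, and $(Z,\iota,\kappa)$ a Kruskal fixed point of $W$ over $X$. The following are equivalent: (i) $\operatorname{rng}(\iota)\cup\operatorname{rng}(\kappa)=Z$; for all $x,y\in X$, $x\leq_X y$ implies $\iota(x)\leq_Z\iota(y)$; and there is a function $h:Z\to\mathbb N$ such that $s\in\operatorname{supp}^W_Z(\sigma)$ implies $h(s)<h(\kappa(\sigma))$ for all $s\in Z$ and $\sigma\in W(Z)$. (ii) The Kruskal fixed point $(Z,\iota,\kappa)$ is initial.
   Context: A quasi embedding between partial orders $X,Y$ is a function $f$ with $f(x)\leq_Y f(y)\Rightarrow x\leq_X y$; an embedding also satisfies the converse. $\mathrm{PO}$ is the category of partial orders and quasi embeddings. $[X]^{<\omega}$ denotes the finite subsets of $X$, with $[f]^{<\omega}(a)=\{f(x)\mid x\in a\}$. A PO-dilator is a functor $W:\mathrm{PO}\to\mathrm{PO}$ mapping embeddings to embeddings, with a natural transformation $\operatorname{supp}^W:W\Rightarrow[\cdot]^{<\omega}$ such that for every embedding $f:X\to Y$, $\operatorname{rng}(W(f))=\{\sigma\in W(Y)\mid\operatorname{supp}^W_Y(\sigma)\subseteq\operatorname{rng}(f)\}$. For finite $a,b\subseteq X$, $a\leq^{\mathrm{fin}}_X b$ iff every $x\in a$ has some $y\in b$ with $x\leq_X y$ (for an element $z$, $z\leq^{\mathrm{fin}}_X b$ means $\{z\}\leq^{\mathrm{fin}}_X b$). $W$ is normal if $\sigma\leq_{W(X)}\tau$ implies $\operatorname{supp}^W_X(\sigma)\leq^{\mathrm{fin}}_X\operatorname{supp}^W_X(\tau)$.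 A Kruskal fixed point of a normal PO-dilator $W$ over a partial order $X$ is a partial order $Z$ with functions $\iota:X\to Z$ and $\kappa:W(Z)\to Z$ such that $\operatorname{rng}(\iota)\cap\operatorname{rng}(\kappa)=\emptyset$ and: $\iota(x)\leq_Z\iota(y)$ implies $x\leq_X y$; $\iota(x)\leq_Z\kappa(\tau)$ iff $\iota(x)\leq^{\mathrm{fin}}_Z\operatorname{supp}^W_Z(\tau)$; $\kappa(\sigma)\not\leq_Z\iota(y)$ for all $\sigma,y$; and $\kappa(\sigma)\leq_Z\kappa(\tau)$ iff ($\sigma\leq_{W(Z)}\tau$ or $\kappa(\sigma)\leq^{\mathrm{fin}}_Z\operatorname{supp}^W_Z(\tau)$), for all $x,y\in X$, $\sigma,\tau\in W(Z)$. Such a Kruskal fixed point $(Z,\iota,\kappa)$ is initial if for every Kruskal fixed point $(Z',\iota',\kappa')$ of $W$ over $X$ there is a unique quasi embedding $f:Z\to Z'$ with $f\circ\iota=\iota'$ and $f\circ\kappa=\kappa'\circ W(f)$. -}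

module Defs where

open import Level using (Level; suc)
open import Data.List.Base using (List; [_]; map)
import Data.List.Membership.Setoid as Membership
import Data.List.Relation.Binary.Subset.Setoid as Subset
open import Data.Product using (_×_; _,_; ∃-syntax; ∃!)
open import Data.Sum.Base using (_⊎_)
open import Function.Base using (_∘_)
open import Function.Bundles using (Func; _⇔_)
open import Function.Construct.Composition using () renaming (function to infixl 9 _⨾_)
open import Function.Construct.Identity using () renaming (function to idFunc)
open import Relation.Binary.Bundles using (Setoid; Poset)
open import Relation.Binary.Definitions using (Monotonic₁)
open import Relation.Nullary.Negation using (¬_)
open import Relation.Unary using (Pred; _∩_; _⊆_; _≐_; Empty)

private
  variable
    ℓ : Level

-- The class of all partial orders is taken relative to a fixed, arbitrary
-- universe level ℓ. Partial orders are setoid-based, so functions between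
-- them respect the underlying equality and equations are stated up to it.
PartialOrder : (ℓ : Level) → Set (suc ℓ)
PartialOrder ℓ = Poset ℓ ℓ ℓ

∣_∣ : PartialOrder ℓ → Set ℓ
∣ X ∣ = Poset.Carrier X

infixr 0 _⟶_

_⟶_ : PartialOrder ℓ → PartialOrder ℓ → Set ℓ
X ⟶ Y = Func (Poset.Eq.setoid X) (Poset.Eq.setoid Y)

rng : {S T : Setoid ℓ ℓ} → Func S T → Pred (Setoid.Carrier T) ℓ
rng {T = T} f y = ∃[ x ] Func.to f x ≈ y
  where open Setoid T using (_≈_)

module _ (X Y : PartialOrder ℓ) where
  private
    module X = Poset X
    module Y = Poset Y

  record QuasiEmbedding : Set ℓ where
    field
      func   : X ⟶ Y
    open Func func public using (to; cong)
    field
      cancel : ∀ {x y} → to x Y.≤ to y → x X.≤ y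

module _ {X Y : PartialOrder ℓ} where
  private
    module X = Poset X
    module Y = Poset Y
  open QuasiEmbedding

  IsEmbedding : QuasiEmbedding X Y → Set ℓ
  IsEmbedding f = Monotonic₁ X._≤_ Y._≤_ (to f)

  infix 4 _≗_

  _≗_ : QuasiEmbedding X Y → QuasiEmbedding X Y → Set ℓ
  f ≗ g = ∀ x → to f x Y.≈ to g x

idQ : (X : PartialOrder ℓ) → QuasiEmbedding X X
idQ X = record
  { func   = idFunc (Poset.Eq.setoid X)
  ; cancel = λ x≤y → x≤y
  }

infixr 9 _∘Q_

_∘Q_ : {X Y Z : PartialOrder ℓ} →
       QuasiEmbedding Y Z → QuasiEmbedding X Y → QuasiEmbedding X Z
g ∘Q f = record
  { func   = F.func ⨾ G.func
  ; cancel = F.cancel ∘ G.cancel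
  }
  where
  module F = QuasiEmbedding f
  module G = QuasiEmbedding g

-- Finite subsets are lists, identified when they have the same elements.
FinSubset : PartialOrder ℓ → Setoid ℓ ℓ
FinSubset X = record
  { Carrier       = List ∣ X ∣
  ; _≈_           = λ a b → a S.⊆ b × b S.⊆ a
  ; isEquivalence = record
    { refl  = (λ p → p) , (λ p → p)
    ; sym   = λ (a⊆b , b⊆a) → b⊆a , a⊆b
    ; trans = λ (a⊆b , b⊆a) (b⊆c , c⊆b) → (λ p → b⊆c (a⊆b p)) , (λ p → b⊆a (c⊆b p))
    }
  }
  where module S = Subset (Poset.Eq.setoid X)

infix 4 Elem FinLeq

Elem : (X : PartialOrder ℓ) → ∣ X ∣ → List ∣ X ∣ → Set ℓ
Elem X = Membership._∈_ (Poset.Eq.setoid X)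

syntax Elem X x a = x ∈[ X ] a

FinLeq : (X : PartialOrder ℓ) → List ∣ X ∣ → List ∣ X ∣ → Set ℓ
FinLeq X a b = ∀ {x} → x ∈[ X ] a → ∃[ y ] y ∈[ X ] b × x ≤ y
  where open Poset X using (_≤_)

syntax FinLeq X a b = a ≤fin[ X ] b

record PODilator (ℓ : Level) : Set (suc ℓ) where
  field
    F₀   : PartialOrder ℓ → PartialOrder ℓ
    F₁   : ∀ {X Y} → QuasiEmbedding X Y → QuasiEmbedding (F₀ X) (F₀ Y)

    F-resp-≗     : ∀ {X Y} {f g : QuasiEmbedding X Y} → f ≗ g → F₁ f ≗ F₁ g
    identity     : ∀ {X} → F₁ (idQ X) ≗ idQ (F₀ X)
    homomorphism : ∀ {X Y Z} (f : QuasiEmbedding X Y) (g : QuasiEmbedding Y Z) →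
                   F₁ (g ∘Q f) ≗ F₁ g ∘Q F₁ f

    F₁-embedding : ∀ {X Y} (f : QuasiEmbedding X Y) → IsEmbedding f → IsEmbedding (F₁ f)

    suppFunc : ∀ X → Func (Poset.Eq.setoid (F₀ X)) (FinSubset X)

  supp : ∀ X → ∣ F₀ X ∣ → List ∣ X ∣
  supp X = Func.to (suppFunc X)

  field
    supp-natural : ∀ {X Y} (f : QuasiEmbedding X Y) (σ : ∣ F₀ X ∣) →
                   Setoid._≈_ (FinSubset Y)
                     (supp Y (QuasiEmbedding.to (F₁ f) σ))
                     (map (QuasiEmbedding.to f) (supp X σ))

    supp-range   : ∀ {X Y} (f : QuasiEmbedding X Y) → IsEmbedding f →
                   rng (QuasiEmbedding.func (F₁ f))
                     ≐ (λ σ → (λ y → y ∈[ Y ] supp Y σ) ⊆ rng (QuasiEmbedding.func f))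

Normal : PODilator ℓ → Set (suc ℓ)
Normal W = ∀ X {σ τ} → Poset._≤_ (F₀ X) σ τ → supp X σ ≤fin[ X ] supp X τ
  where open PODilator W

record KruskalFixedPoint (W : PODilator ℓ) (X : PartialOrder ℓ) : Set (suc ℓ) where
  open PODilator W
  field
    Z     : PartialOrder ℓ
    ιFunc : X ⟶ Z
    κFunc : F₀ Z ⟶ Z

  open Func ιFunc public using () renaming (to to ι)
  open Func κFunc public using () renaming (to to κ)
  private
    module X  = Poset X
    module Z  = Poset Z
    module WZ = Poset (F₀ Z)

  field
    disjoint : Empty (rng ιFunc ∩ rng κFunc)
    ι≤ι      : ∀ x y → ι x Z.≤ ι y → x X.≤ y
    ι≤κ      : ∀ x τ → ι x Z.≤ κ τ ⇔ [ ι x ] ≤fin[ Z ] supp Z τ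
    κ≰ι      : ∀ σ y → ¬ (κ σ Z.≤ ι y)
    κ≤κ      : ∀ σ τ → κ σ Z.≤ κ τ ⇔ (σ WZ.≤ τ ⊎ [ κ σ ] ≤fin[ Z ] supp Z τ)

module _ {W : PODilator ℓ} {X : PartialOrder ℓ} where
  open PODilator W
  open QuasiEmbedding

  IsMorphism : (K K′ : KruskalFixedPoint W X) →
               QuasiEmbedding (KruskalFixedPoint.Z K) (KruskalFixedPoint.Z K′) → Set ℓ
  IsMorphism K K′ f =
      (∀ x → to f (K.ι x) K′.≈ K′.ι x)
    × (∀ σ → to f (K.κ σ) K′.≈ K′.κ (to (F₁ f) σ))
    where
    module K = KruskalFixedPoint K
    module K′ where
      open KruskalFixedPoint K′ public
      open Poset Z public using (_≈_)

  Initial : KruskalFixedPoint W X → Set (suc ℓ)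
  Initial K = (K′ : KruskalFixedPoint W X) → ∃! _≗_ (IsMorphism K K′)

{-# OPTIONS --safe #-}

-- Joining the units to W gives a normal dilator V = X + W, and a Kruskal fixed
-- point becomes a map κ : V(Z) → Z in which κ c ≤ κ d implies that c ≤ d or that
-- κ c lies below a member of supp d.  Condition (i) says that κ is surjective,
-- that the converse implication holds, and that Z is ranked.
--
-- (i) ⇒ (ii): members of supp d have smaller rank than κ d, so κ is injective.
-- Quasi embeddings f on {z | rank z < n} with f (κ c) = κ′ (V f c) are then unique
-- and exist by recursion on n, and together they form the morphism.
--
-- (ii) ⇒ (i): iterating V along the order that the fixed point must carry gives
-- a chain of partial orders, starting from the empty one, whose colimit is a
-- Kruskal fixed point satisfying (i).  An initial K has morphisms to and from it
-- whose composite on K is the identity, and (i) is transported along them.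
module Submission where

open import Defs
open import Level using (Level; suc; Lift)
open import Data.Empty using (⊥)
open import Data.List.Base using (List; []; _∷_; [_]; foldr)
open import Data.List.Relation.Unary.Any using (here; there)
import Data.List.Membership.Setoid.Properties as Membership
open import Data.Nat.Base as ℕ using (ℕ; _<_; _⊔_; s≤s; s≤s⁻¹; _≤′_; ≤′-refl; ≤′-step)
import Data.Nat.Properties as ℕ
open import Data.Product using (_×_; Σ-syntax; _,_; proj₁; proj₂; ∃-syntax; ∃!)
open import Data.Sum.Base as Sum using (_⊎_; inj₁; inj₂)
open import Data.Sum.Relation.Binary.Pointwise as Pointwise using (inj₁; inj₂)
open import Function.Bundles using (Func; _⇔_; mk⇔; Equivalence)
open import Relation.Binary.Bundles using (Poset)
import Relation.Binary.Construct.On as On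
open import Relation.Binary.PropositionalEquality as ≡ using (_≡_; setoid)
open import Relation.Nullary.Negation using (contradiction)
open import Relation.Unary using (Universal; _∪_)

open QuasiEmbedding using (to; cancel) renaming (cong to to-cong)

private
  variable
    ℓ : Level

-- Partial orders and quasi embeddings up to equality.

module _ (X : PartialOrder ℓ) where
  open Poset X

  ≈-from-≤ : ∀ {x x′ y y′} → x ≈ y → x′ ≈ y′ → x ≤ x′ → y ≤ y′
  ≈-from-≤ x≈y x′≈y′ x≤x′ = trans (reflexive (Eq.sym x≈y)) (trans x≤x′ (reflexive x′≈y′))

  ∈-resp-≈ : ∀ {x y a} → x ≈ y → x ∈[ X ] a → y ∈[ X ] a
  ∈-resp-≈ = Membership.∈-resp-≈ Eq.setoid

  restrict : {B : Set ℓ} → (B → ∣ X ∣) → PartialOrder ℓ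
  restrict = On.poset X

  inclusion : {B : Set ℓ} (g : B → ∣ X ∣) → QuasiEmbedding (restrict g) X
  inclusion g = record { func = record { to = g ; cong = λ p → p } ; cancel = λ p → p }

cancel-≈ : {X Y : PartialOrder ℓ} (f : QuasiEmbedding X Y) →
           ∀ {x y} → Poset._≈_ Y (to f x) (to f y) → Poset._≈_ X x y
cancel-≈ {X = X} {Y} f p =
  Poset.antisym X (cancel f (Poset.reflexive Y p)) (cancel f (Poset.reflexive Y (Poset.Eq.sym Y p)))

-- Supports in a dilator, and algebras for it.

module Dilator (W : PODilator ℓ) where
  open PODilator W

  supp-cong : ∀ {X c d x} → Poset._≈_ (F₀ X) c d → x ∈[ X ] supp X c → x ∈[ X ] supp X d
  supp-cong {X} c≈d = proj₁ (Func.cong (suppFunc X) c≈d)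

  module _ {X Y : PartialOrder ℓ} (f : QuasiEmbedding X Y) where
    open Poset Y using (_≈_; module Eq)

    ∈-supp-map⁺ : ∀ {c x} → x ∈[ X ] supp X c → to f x ∈[ Y ] supp Y (to (F₁ f) c)
    ∈-supp-map⁺ {c} x∈c = proj₂ (supp-natural f c)
      (Membership.∈-map⁺ (Poset.Eq.setoid X) (Poset.Eq.setoid Y) (to-cong f) x∈c)

    ∈-supp-map⁻ : ∀ {c y} → y ∈[ Y ] supp Y (to (F₁ f) c) → ∃[ x ] x ∈[ X ] supp X c × to f x ≈ y
    ∈-supp-map⁻ {c} y∈fc
      with x , x∈c , y≈fx ← Membership.∈-map⁻ (Poset.Eq.setoid X) (Poset.Eq.setoid Y)
                              (proj₁ (supp-natural f c) y∈fc)
      = x , x∈c , Eq.sym y≈fx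

  F₁-∘ : ∀ {X Y Z} {f : QuasiEmbedding X Y} {g : QuasiEmbedding Y Z} {h : QuasiEmbedding X Z} →
         (∀ x → Poset._≈_ Z (to g (to f x)) (to h x)) →
         ∀ c → Poset._≈_ (F₀ Z) (to (F₁ g) (to (F₁ f) c)) (to (F₁ h) c)
  F₁-∘ {Z = Z} {f} {g} {h} gf≗h c =
    F₀Z.trans (F₀Z.sym (homomorphism f g c)) (F-resp-≗ {f = g ∘Q f} {g = h} gf≗h c)
    where module F₀Z = Poset.Eq (F₀ Z)

  -- Both elements come from an element over their common support in Z.
  F₁-agree : ∀ {Y₁ Y₂ Z V}
    (i₁ : QuasiEmbedding Y₁ Z) (i₂ : QuasiEmbedding Y₂ Z) → IsEmbedding i₁ → IsEmbedding i₂ →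
    (f₁ : QuasiEmbedding Y₁ V) (f₂ : QuasiEmbedding Y₂ V) → ∀ {c₁ c₂} →
    Poset._≈_ (F₀ Z) (to (F₁ i₁) c₁) (to (F₁ i₂) c₂) →
    (∀ {y₁ y₂} → y₁ ∈[ Y₁ ] supp Y₁ c₁ → y₂ ∈[ Y₂ ] supp Y₂ c₂ →
      Poset._≈_ Z (to i₁ y₁) (to i₂ y₂) → Poset._≈_ V (to f₁ y₁) (to f₂ y₂)) →
    Poset._≈_ (F₀ V) (to (F₁ f₁) c₁) (to (F₁ f₂) c₂)
  F₁-agree {Y₁} {Y₂} {Z} {V} i₁ i₂ i₁-emb i₂-emb f₁ f₂ {c₁} {c₂} i₁c₁≈i₂c₂ agree =
    F₀V.trans (to-cong (F₁ f₁) c₁≈)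
      (F₀V.trans (F₁-∘ {f = k₁} {g = f₁} {h = f₂ ∘Q k₂} f₁k₁≗f₂k₂ c)
        (F₀V.trans (homomorphism k₂ f₂ c) (to-cong (F₁ f₂) (F₀Y₂.sym c₂≈))))
    where
    module Z = Poset Z
    module F₀Z = Poset.Eq (F₀ Z)
    module F₀V = Poset.Eq (F₀ V)
    module F₀Y₂ = Poset.Eq (F₀ Y₂)

    B : Set _
    B = ∃[ z ] z ∈[ Z ] supp Z (to (F₁ i₁) c₁)

    A : PartialOrder _
    A = restrict Z {B} proj₁

    j : QuasiEmbedding A Z
    j = inclusion Z {B} proj₁

    -- Chosen preimages form a quasi embedding because `i` preserves the order: a comparison of
    -- preimages is sent back to one in `Z`.
    lift : ∀ {Y} (i : QuasiEmbedding Y Z) → IsEmbedding i →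
           ((b : B) → ∃[ y ] to i y Z.≈ proj₁ b) → QuasiEmbedding A Y
    lift i i-emb g = record
      { func = record
        { to = λ b → proj₁ (g b)
        ; cong = λ {a} {b} a≈b →
            cancel-≈ i (Z.Eq.trans (proj₂ (g a)) (Z.Eq.trans a≈b (Z.Eq.sym (proj₂ (g b)))))
        }
      ; cancel = λ {a} {b} p → ≈-from-≤ Z (proj₂ (g a)) (proj₂ (g b)) (i-emb p)
      }

    pre₁ : (b : B) → ∃[ y ] y ∈[ Y₁ ] supp Y₁ c₁ × to i₁ y Z.≈ proj₁ b
    pre₁ (z , z∈) = ∈-supp-map⁻ i₁ z∈

    pre₂ : (b : B) → ∃[ y ] y ∈[ Y₂ ] supp Y₂ c₂ × to i₂ y Z.≈ proj₁ b
    pre₂ (z , z∈) = ∈-supp-map⁻ i₂ (supp-cong i₁c₁≈i₂c₂ z∈)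

    k₁ : QuasiEmbedding A Y₁
    k₁ = lift i₁ i₁-emb λ b → proj₁ (pre₁ b) , proj₂ (proj₂ (pre₁ b))

    k₂ : QuasiEmbedding A Y₂
    k₂ = lift i₂ i₂-emb λ b → proj₁ (pre₂ b) , proj₂ (proj₂ (pre₂ b))

    lifted = proj₂ (supp-range j (λ p → p)) {to (F₁ i₁) c₁} (λ z∈ → (_ , z∈) , Z.Eq.refl)

    c : ∣ F₀ A ∣
    c = proj₁ lifted

    c₁≈ : Poset._≈_ (F₀ Y₁) c₁ (to (F₁ k₁) c)
    c₁≈ = cancel-≈ (F₁ i₁) (F₀Z.trans (F₀Z.sym (proj₂ lifted))
      (F₀Z.sym (F₁-∘ {f = k₁} {g = i₁} {h = j} (λ b → proj₂ (proj₂ (pre₁ b))) c)))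

    c₂≈ : Poset._≈_ (F₀ Y₂) c₂ (to (F₁ k₂) c)
    c₂≈ = cancel-≈ (F₁ i₂) (F₀Z.trans (F₀Z.sym i₁c₁≈i₂c₂) (F₀Z.trans (F₀Z.sym (proj₂ lifted))
      (F₀Z.sym (F₁-∘ {f = k₂} {g = i₂} {h = j} (λ b → proj₂ (proj₂ (pre₂ b))) c))))

    f₁k₁≗f₂k₂ : ∀ b → Poset._≈_ V (to f₁ (to k₁ b)) (to f₂ (to k₂ b))
    f₁k₁≗f₂k₂ b = agree (proj₁ (proj₂ (pre₁ b))) (proj₁ (proj₂ (pre₂ b)))
      (Z.Eq.trans (proj₂ (proj₂ (pre₁ b))) (Z.Eq.sym (proj₂ (proj₂ (pre₂ b)))))

  -- One implication is imposed because `ι` in an arbitrary Kruskal fixed point may fail to be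
  -- monotone. Every Kruskal fixed point can thus be a target of the recursion.
  record Algebra : Set (suc ℓ) where
    field
      Z     : PartialOrder ℓ
      κFunc : F₀ Z ⟶ Z
    open Func κFunc public renaming (to to κ; cong to κ-cong)
    open Poset Z public
    field
      κ≤κ⁻ : ∀ c d → κ c ≤ κ d → Poset._≤_ (F₀ Z) c d ⊎ ∃[ s ] s ∈[ Z ] supp Z d × κ c ≤ s

  record Generated (A : Algebra) : Set ℓ where
    open Algebra A
    field
      κ-surjective : ∀ z → ∃[ c ] κ c ≈ z
      κ-mono       : ∀ {c d} → Poset._≤_ (F₀ Z) c d → κ c ≤ κ d
      ≤κ           : ∀ {c d s} → s ∈[ Z ] supp Z d → κ c ≤ s → κ c ≤ κ d
      rankFunc     : Func Eq.setoid (setoid ℕ)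
    open Func rankFunc public renaming (to to rank; cong to rank-cong)
    field
      rank-< : ∀ {s c} → s ∈[ Z ] supp Z c → rank s < rank (κ c)

    -- By surjectivity `s` is some `κ d`, and `≤κ` applies to the trivial comparison `κ d ≤ s`.
    supp≤κ : ∀ {s c} → s ∈[ Z ] supp Z c → s ≤ κ c
    supp≤κ {s} s∈c with κ-surjective s
    ... | d , κd≈s = trans (reflexive (Eq.sym κd≈s)) (≤κ s∈c (reflexive κd≈s))

    -- If `κ c` were below a member `s` of `supp d`, then `s ≤ κ d ≈ κ c ≤ s` would identify `s`
    -- with `κ d`, although its rank is smaller.
    κ-cancel : ∀ {c d} → κ c ≈ κ d → Poset._≤_ (F₀ Z) c d
    κ-cancel {c} {d} κc≈κd with κ≤κ⁻ c d (reflexive κc≈κd)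
    ... | inj₁ c≤d = c≤d
    ... | inj₂ (s , s∈d , κc≤s) = contradiction (rank-< s∈d) (ℕ.<-irrefl (rank-cong s≈κd))
      where s≈κd = antisym (supp≤κ s∈d) (trans (reflexive (Eq.sym κc≈κd)) κc≤s)

    κ-injective : ∀ {c d} → κ c ≈ κ d → Poset._≈_ (F₀ Z) c d
    κ-injective κc≈κd = Poset.antisym (F₀ Z) (κ-cancel κc≈κd) (κ-cancel (Eq.sym κc≈κd))

  -- Recursion along the rank of a generated algebra.

  module Recursion (A B : Algebra) (gen : Generated A) where
    private
      module A = Algebra A
      module B = Algebra B
    open Generated gen

    module _ {Y : PartialOrder ℓ} (i : QuasiEmbedding Y A.Z) (f : QuasiEmbedding Y B.Z) where

      -- `Y` need not be closed under `κ`, so the morphism equation cannot be stated on it. Instead,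
      -- a pair fits the equation if both entries are built from one `c` over `Y`.
      Follows : ∣ A.Z ∣ → ∣ B.Z ∣ → Set ℓ
      Follows z v = ∃[ c ] A.κ (to (F₁ i) c) A.≈ z × B.κ (to (F₁ f) c) B.≈ v

      IsPartialMorphism : Set ℓ
      IsPartialMorphism = ∀ y → Follows (to i y) (to f y)

    record PartialMorphism {Y : PartialOrder ℓ} (i : QuasiEmbedding Y A.Z) : Set ℓ where
      field
        map      : QuasiEmbedding Y B.Z
        follows  : IsPartialMorphism i map
    open PartialMorphism

    -- By `κ-injective` the two codes become equal over `A.Z`, and `F₁-agree` reduces the claim to
    -- support members, whose rank is smaller. Allowing two domains gives coherence of the stages
    -- and uniqueness of the morphism by one induction.
    functional′ : ∀ {Y₁ Y₂} (i₁ : QuasiEmbedding Y₁ A.Z) (i₂ : QuasiEmbedding Y₂ A.Z) →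
      IsEmbedding i₁ → IsEmbedding i₂ →
      (p₁ : PartialMorphism i₁) (p₂ : PartialMorphism i₂) → ∀ n {z₁ z₂ v₁ v₂} → rank z₁ < n →
      Follows i₁ (map p₁) z₁ v₁ → Follows i₂ (map p₂) z₂ v₂ → z₁ A.≈ z₂ → v₁ B.≈ v₂
    functional′ i₁ i₂ e₁ e₂ p₁ p₂ (ℕ.suc n) h<n (c₁ , z₁≈ , v₁≈) (c₂ , z₂≈ , v₂≈) z₁≈z₂ =
      B.Eq.trans (B.Eq.sym v₁≈) (B.Eq.trans (B.κ-cong fc₁≈fc₂) v₂≈)
      where
      fc₁≈fc₂ = F₁-agree i₁ i₂ e₁ e₂ (map p₁) (map p₂)
        (κ-injective (A.Eq.trans z₁≈ (A.Eq.trans z₁≈z₂ (A.Eq.sym z₂≈))))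
        λ {y₁} {y₂} y₁∈ _ → functional′ i₁ i₂ e₁ e₂ p₁ p₂ n
          (ℕ.<-≤-trans (≡.subst (rank (to i₁ y₁) <_) (rank-cong z₁≈) (rank-< (∈-supp-map⁺ i₁ y₁∈)))
                       (s≤s⁻¹ h<n))
          (follows p₁ y₁) (follows p₂ y₂)

    functional : ∀ {Y₁ Y₂} (i₁ : QuasiEmbedding Y₁ A.Z) (i₂ : QuasiEmbedding Y₂ A.Z) →
      IsEmbedding i₁ → IsEmbedding i₂ →
      (p₁ : PartialMorphism i₁) (p₂ : PartialMorphism i₂) → ∀ {z₁ z₂ v₁ v₂} →
      Follows i₁ (map p₁) z₁ v₁ → Follows i₂ (map p₂) z₂ v₂ → z₁ A.≈ z₂ → v₁ B.≈ v₂
    functional i₁ i₂ e₁ e₂ p₁ p₂ = functional′ i₁ i₂ e₁ e₂ p₁ p₂ _ ℕ.≤-refl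

    -- Induction on a bound for the rank of `z₂`, with `z₁` fixed. A comparison of codes is
    -- reflected by `F₁ (map p)`. Otherwise `v₁` lies below the image of some `y` in the support of
    -- `c₂`, and `to i y` has smaller rank than `z₂`.
    reflects : ∀ {Y} (i : QuasiEmbedding Y A.Z) → IsEmbedding i → (p : PartialMorphism i) →
      ∀ n {z₁ z₂ v₁ v₂} → rank z₂ < n →
      Follows i (map p) z₁ v₁ → Follows i (map p) z₂ v₂ → v₁ B.≤ v₂ → z₁ A.≤ z₂
    reflects i e p (ℕ.suc n) h<n r₁@(c₁ , z₁≈ , v₁≈) (c₂ , z₂≈ , v₂≈) v₁≤v₂
      with B.κ≤κ⁻ _ _ (≈-from-≤ B.Z (B.Eq.sym v₁≈) (B.Eq.sym v₂≈) v₁≤v₂)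
    ... | inj₁ fc₁≤fc₂ = ≈-from-≤ A.Z z₁≈ z₂≈ (κ-mono (F₁-embedding i e (cancel (F₁ (map p)) fc₁≤fc₂)))
    ... | inj₂ (t , t∈ , ≤t) with ∈-supp-map⁻ (map p) t∈
    ...   | y , y∈ , fy≈t = ≈-from-≤ A.Z z₁≈ z₂≈ (≤κ iy∈ (A.trans (A.reflexive z₁≈) z₁≤iy))
      where
      iy∈ = ∈-supp-map⁺ i y∈
      z₁≤iy = reflects i e p n
        (ℕ.<-≤-trans (≡.subst (rank (to i y) <_) (rank-cong z₂≈) (rank-< iy∈)) (s≤s⁻¹ h<n))
        r₁ (follows p y)
        (≈-from-≤ B.Z v₁≈ (B.Eq.sym fy≈t) ≤t)

    transfer : ∀ {Y₁ Y₂} {i₁ : QuasiEmbedding Y₁ A.Z} {i₂ : QuasiEmbedding Y₂ A.Z}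
      {f₁ : QuasiEmbedding Y₁ B.Z} {f₂ : QuasiEmbedding Y₂ B.Z} (k : QuasiEmbedding Y₁ Y₂) →
      (∀ y → to i₂ (to k y) A.≈ to i₁ y) → (∀ y → to f₂ (to k y) B.≈ to f₁ y) →
      ∀ {z v} → Follows i₁ f₁ z v → Follows i₂ f₂ z v
    transfer {i₁ = i₁} {i₂} {f₁} {f₂} k i₂k≗i₁ f₂k≗f₁ (c , z≈ , v≈) = to (F₁ k) c
      , A.Eq.trans (A.κ-cong (F₁-∘ {f = k} {g = i₂} {h = i₁} i₂k≗i₁ c)) z≈
      , B.Eq.trans (B.κ-cong (F₁-∘ {f = k} {g = f₂} {h = f₁} f₂k≗f₁ c)) v≈

    Below : ℕ → Set ℓ
    Below n = Σ[ z ∈ ∣ A.Z ∣ ] rank z < n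

    below : ∀ n → QuasiEmbedding (restrict A.Z proj₁) A.Z
    below n = inclusion A.Z {Below n} proj₁

    stage : ∀ n → PartialMorphism (below n)
    stage ℕ.zero = record
      { map = record
        { func = record { to = λ () ; cong = λ { {_ , ()} } }
        ; cancel = λ { {_ , ()} }
        }
      ; follows = λ ()
      }
    stage (ℕ.suc n) = record
      { map = map′
      -- `value` gives codes over `Below n` that follow the old map; `k` turns them into codes over
      -- `Below (suc n)` that follow the new one.
      ; follows = λ y → transfer {f₁ = map p} {f₂ = map′} k (λ _ → A.Eq.refl) map′∘k≗map (proj₂ (value y))
      }
      where
      p = stage n
      func-p : ∀ {z₁ z₂ v₁ v₂} → Follows (below n) (map p) z₁ v₁ →
               Follows (below n) (map p) z₂ v₂ → z₁ A.≈ z₂ → v₁ B.≈ v₂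
      func-p = functional (below n) (below n) (λ p → p) (λ p → p) p p

      value : ((z , _) : Below (ℕ.suc n)) → ∃[ v ] Follows (below n) (map p) z v
      value (z , h<) with κ-surjective z
      -- Members of `supp c` have smaller rank than `z`, so they lie in `Below n` and `c` comes from
      -- some `c₀` over `Below n`.
      ... | c , κc≈z with proj₂ (supp-range (below n) (λ p → p)) {c} (λ {s} s∈c →
              (s , ℕ.<-≤-trans (≡.subst (rank s <_) (rank-cong κc≈z) (rank-< s∈c)) (s≤s⁻¹ h<)) , A.Eq.refl)
      ...   | c₀ , ic₀≈c = _ , c₀ , A.Eq.trans (A.κ-cong ic₀≈c) κc≈z , B.Eq.refl

      map′ : QuasiEmbedding (restrict A.Z {Below (ℕ.suc n)} proj₁) B.Z
      map′ = record
        { func = record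
          { to = λ y → proj₁ (value y)
          ; cong = λ {y₁} {y₂} → func-p (proj₂ (value y₁)) (proj₂ (value y₂))
          }
        ; cancel = λ {y₁} {y₂} →
            reflects (below n) (λ p → p) p _ ℕ.≤-refl (proj₂ (value y₁)) (proj₂ (value y₂))
        }

      k : QuasiEmbedding (restrict A.Z {Below n} proj₁) (restrict A.Z {Below (ℕ.suc n)} proj₁)
      k = record
        { func = record { to = λ (z , h<) → z , ℕ.m<n⇒m<1+n h< ; cong = λ p → p }
        ; cancel = λ p → p
        }

      map′∘k≗map : ∀ y → to map′ (to k y) B.≈ to (map p) y
      map′∘k≗map y = func-p (proj₂ (value (to k y))) (follows p y) A.Eq.refl

    coherent : ∀ m n (y : Below m) (z : Below n) → proj₁ y A.≈ proj₁ z →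
               to (map (stage m)) y B.≈ to (map (stage n)) z
    coherent m n y z = functional (below m) (below n) (λ p → p) (λ p → p) (stage m) (stage n)
      (follows (stage m) y) (follows (stage n) z)

    self : ∀ z → Below (ℕ.suc (rank z))
    self z = z , ℕ.≤-refl

    at : ∣ A.Z ∣ → ∣ B.Z ∣
    at z = to (map (stage (ℕ.suc (rank z)))) (self z)

    at≈stage : ∀ n (y : Below n) → at (proj₁ y) B.≈ to (map (stage n)) y
    at≈stage n y = coherent (ℕ.suc (rank (proj₁ y))) n (self (proj₁ y)) y A.Eq.refl

    rec : QuasiEmbedding A.Z B.Z
    rec = record
      { func = record
        { to = at
        ; cong = λ {z} {w} → coherent (ℕ.suc (rank z)) (ℕ.suc (rank w)) (self z) (self w)
        }
      ; cancel = λ {z} {w} at-z≤at-w →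
          -- Both arguments lie in stage `N`, whose map reflects the order.
          let N = ℕ.suc (rank z ⊔ rank w)
              z∈N = z , s≤s (ℕ.m≤m⊔n (rank z) (rank w))
              w∈N = w , s≤s (ℕ.m≤n⊔m (rank z) (rank w))
          in cancel (map (stage N)) {z∈N} {w∈N}
               (≈-from-≤ B.Z (at≈stage N z∈N) (at≈stage N w∈N) at-z≤at-w)
      }

    -- This brings `rec` within reach of `functional`, from which both the morphism equation and
    -- uniqueness follow.
    total : PartialMorphism (idQ A.Z)
    total = record
      { map = rec
      ; follows = λ z →
          let n = ℕ.suc (rank z) in
          transfer {f₁ = map (stage n)} {f₂ = rec} (below n) (λ _ → A.Eq.refl)
            (at≈stage n) (follows (stage n) (self z))
      }

    IsAlgebraMorphism : QuasiEmbedding A.Z B.Z → Set ℓ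
    IsAlgebraMorphism f = ∀ c → to f (A.κ c) B.≈ B.κ (to (F₁ f) c)

    follows-κ : ∀ f c → Follows (idQ A.Z) f (A.κ c) (B.κ (to (F₁ f) c))
    follows-κ f c = c , A.κ-cong (identity c) , B.Eq.refl

    rec-morphism : IsAlgebraMorphism rec
    rec-morphism c = functional (idQ A.Z) (idQ A.Z) (λ p → p) (λ p → p) total total
      (follows total (A.κ c)) (follows-κ rec c) A.Eq.refl

    rec-unique : ∀ {f} → IsAlgebraMorphism f → rec ≗ f
    rec-unique {f} f-mor z = functional (idQ A.Z) (idQ A.Z) (λ p → p) (λ p → p) total
      record { map = f ; follows = f-follows } (follows total z) (f-follows z) A.Eq.refl
      where
      -- Since `κ` is surjective, any morphism is also a partial morphism along the identity.
      f-follows : IsPartialMorphism (idQ A.Z) f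
      f-follows z with κ-surjective z
      ... | c , κc≈z = c , A.Eq.trans (A.κ-cong (identity c)) κc≈z
                         , B.Eq.trans (B.Eq.sym (f-mor c)) (to-cong f κc≈z)

-- Maxima over finite subsets.

module _ (X : PartialOrder ℓ) (h : ∣ X ∣ → ℕ) (h-mono : ∀ {x y} → Poset._≤_ X x y → h x ℕ.≤ h y) where

  sup : List ∣ X ∣ → ℕ
  sup = foldr (λ x n → h x ⊔ n) 0

  ≤sup : ∀ {x a} → x ∈[ X ] a → h x ℕ.≤ sup a
  ≤sup (here x≈y) = ℕ.≤-trans (h-mono (Poset.reflexive X x≈y)) (ℕ.m≤m⊔n _ _)
  ≤sup (there x∈a) = ℕ.≤-trans (≤sup x∈a) (ℕ.m≤n⊔m _ _)

  sup≤ : ∀ {n} a → (∀ {x} → x ∈[ X ] a → h x ℕ.≤ n) → sup a ℕ.≤ n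
  sup≤ [] bound = ℕ.z≤n
  sup≤ (x ∷ a) bound = ℕ.⊔-lub (bound (here (Poset.Eq.refl X))) (sup≤ a (λ p → bound (there p)))

-- Iterating the dilator along the order of the fixed point.

module Construction (W : PODilator ℓ) (normal : Normal W) where
  open PODilator W
  open Dilator W

  -- c ⊑ t says that κ c ≤ t holds in the fixed point, where t is κ (code t).
  data Under (Y : PartialOrder ℓ) (code : Y ⟶ F₀ Y) (c : ∣ F₀ Y ∣) : ∣ Y ∣ → Set ℓ where
    direct : ∀ {t} → Poset._≤_ (F₀ Y) c (Func.to code t) → Under Y code c t
    deeper : ∀ {s t} → s ∈[ Y ] supp Y (Func.to code t) → Under Y code c s → Under Y code c t

  -- An approximation of the fixed point, where `κ` will send `code y` to `y`. `≤⇒⊑` and `⊑⇒≤` make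
  -- the order the one that the fixed point condition forces on codes, and `rank-code` ties the
  -- height to the nesting depth of codes.
  record Stage : Set (suc ℓ) where
    field
      Y        : PartialOrder ℓ
      codeFunc : Y ⟶ F₀ Y
    open Func codeFunc public renaming (to to code; cong to code-cong)
    open Poset Y public
    _⊑_ : ∣ F₀ Y ∣ → ∣ Y ∣ → Set ℓ
    _⊑_ = Under Y codeFunc
    field
      ≤⇒⊑    : ∀ {x y} → x ≤ y → code x ⊑ y
      ⊑⇒≤    : ∀ {x y} → code x ⊑ y → x ≤ y
      height : ∣ Y ∣ → ℕ
      height-mono : ∀ {x y} → x ≤ y → height x ℕ.≤ height y

    rank : ∣ F₀ Y ∣ → ℕ
    rank c = ℕ.suc (sup Y height height-mono (supp Y c))

    field
      rank-code : ∀ y → rank (code y) ≡ height y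

  module Next (S : Stage) where
    open Stage S
    private
      module V = Poset (F₀ Y)

    height<rank : ∀ {s c} → s ∈[ Y ] supp Y c → height s < rank c
    height<rank s∈c = s≤s (≤sup Y height height-mono s∈c)

    rank-mono : ∀ {c d} → c V.≤ d → rank c ℕ.≤ rank d
    rank-mono {c} {d} c≤d = s≤s (sup≤ Y height height-mono (supp Y c) λ x∈c →
      let y , y∈d , x≤y = normal Y c≤d x∈c
      in ℕ.≤-trans (height-mono x≤y) (≤sup Y height height-mono y∈d))

    -- Each `deeper` step passes to a support member, whose height is strictly smaller than that of
    -- `t`. The bound is what makes `≤⁺` antisymmetric.
    ⊑-rank : ∀ {c t} → c ⊑ t → rank c ℕ.≤ height t
    ⊑-rank {t = t} (direct c≤) = ℕ.≤-trans (rank-mono c≤) (ℕ.≤-reflexive (rank-code t))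
    ⊑-rank {t = t} (deeper s∈ c⊑s) =
      ℕ.≤-trans (⊑-rank c⊑s) (ℕ.≤-trans (ℕ.<⇒≤ (height<rank s∈)) (ℕ.≤-reflexive (rank-code t)))

    ≤-⊑-trans : ∀ {c d t} → c V.≤ d → d ⊑ t → c ⊑ t
    ≤-⊑-trans c≤d (direct d≤) = direct (V.trans c≤d d≤)
    ≤-⊑-trans c≤d (deeper s∈ d⊑s) = deeper s∈ (≤-⊑-trans c≤d d⊑s)

    -- In the direct case normality puts `s` below a member `s′` of the support of `code t`, and
    -- `code s ⊑ s′` extends to `t` by one `deeper` step.
    supp-⊑ : ∀ {c s t} → s ∈[ Y ] supp Y c → c ⊑ t → s ≤ t
    supp-⊑ s∈c (direct c≤) with normal Y c≤ s∈c
    ... | s′ , s′∈ , s≤s′ = ⊑⇒≤ (deeper s′∈ (≤⇒⊑ s≤s′))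
    supp-⊑ s∈c (deeper s∈ c⊑s) = ⊑⇒≤ (deeper s∈ (≤⇒⊑ (supp-⊑ s∈c c⊑s)))

    -- Induction on `c ⊑ s`: a direct step composes with `code s ⊑ t`, and a `deeper` one moves to a
    -- member of the support of `code s`, which is below `t` by `supp-⊑`.
    ⊑-≤-trans : ∀ {c s t} → c ⊑ s → s ≤ t → c ⊑ t
    ⊑-≤-trans (direct c≤) s≤t = ≤-⊑-trans c≤ (≤⇒⊑ s≤t)
    ⊑-≤-trans (deeper s∈ c⊑s) s≤t = ⊑-≤-trans c⊑s (supp-⊑ s∈ (≤⇒⊑ s≤t))

    infix 4 _≤⁺_
    -- The fixed point condition for `κ c ≤ κ d`, with `c ⊑ s` standing for `κ c ≤ s`.
    _≤⁺_ : ∣ F₀ Y ∣ → ∣ F₀ Y ∣ → Set ℓ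
    c ≤⁺ d = c V.≤ d ⊎ ∃[ s ] s ∈[ Y ] supp Y d × c ⊑ s

    ≤⁺-trans : ∀ {b c d} → b ≤⁺ c → c ≤⁺ d → b ≤⁺ d
    ≤⁺-trans (inj₁ b≤c) (inj₁ c≤d) = inj₁ (V.trans b≤c c≤d)
    ≤⁺-trans (inj₁ b≤c) (inj₂ (t , t∈d , c⊑t)) = inj₂ (t , t∈d , ≤-⊑-trans b≤c c⊑t)
    ≤⁺-trans (inj₂ (s , s∈c , b⊑s)) (inj₁ c≤d) with normal Y c≤d s∈c
    ... | t , t∈d , s≤t = inj₂ (t , t∈d , ⊑-≤-trans b⊑s s≤t)
    ≤⁺-trans (inj₂ (s , s∈c , b⊑s)) (inj₂ (t , t∈d , c⊑t)) =
      inj₂ (t , t∈d , ⊑-≤-trans b⊑s (supp-⊑ s∈c c⊑t))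

    ≤⁺-rank : ∀ {c d} → c ≤⁺ d → rank c ℕ.≤ rank d
    ≤⁺-rank (inj₁ c≤d) = rank-mono c≤d
    ≤⁺-rank (inj₂ (s , s∈d , c⊑s)) = ℕ.≤-trans (⊑-rank c⊑s) (ℕ.<⇒≤ (height<rank s∈d))

    -- A comparison through a support strictly raises the rank and so excludes the reverse
    -- comparison; only two comparisons in `F₀ Y` remain.
    ≤⁺-antisym : ∀ {c d} → c ≤⁺ d → d ≤⁺ c → c V.≈ d
    ≤⁺-antisym (inj₁ c≤d) (inj₁ d≤c) = V.antisym c≤d d≤c
    ≤⁺-antisym (inj₂ (s , s∈d , c⊑s)) d≤⁺c =
      contradiction (ℕ.<-≤-trans (ℕ.≤-<-trans (⊑-rank c⊑s) (height<rank s∈d)) (≤⁺-rank d≤⁺c)) (ℕ.<-irrefl ≡.refl)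
    ≤⁺-antisym c≤⁺d (inj₂ (s , s∈c , d⊑s)) =
      contradiction (ℕ.<-≤-trans (ℕ.≤-<-trans (⊑-rank d⊑s) (height<rank s∈c)) (≤⁺-rank c≤⁺d)) (ℕ.<-irrefl ≡.refl)

    Y⁺ : PartialOrder ℓ
    Y⁺ = record
      { Carrier = ∣ F₀ Y ∣
      ; _≈_ = V._≈_
      ; _≤_ = _≤⁺_
      ; isPartialOrder = record
        { isPreorder = record
          { isEquivalence = V.isEquivalence
          ; reflexive = λ c≈d → inj₁ (V.reflexive c≈d)
          ; trans = ≤⁺-trans
          }
        ; antisym = ≤⁺-antisym
        }
      }

    ⊑⇒≤⁺ : ∀ {c t} → c ⊑ t → c ≤⁺ code t
    ⊑⇒≤⁺ (direct c≤) = inj₁ c≤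
    ⊑⇒≤⁺ (deeper s∈ c⊑s) = inj₂ (_ , s∈ , c⊑s)

    ≤⁺⇒⊑ : ∀ {c t} → c ≤⁺ code t → c ⊑ t
    ≤⁺⇒⊑ (inj₁ c≤) = direct c≤
    ≤⁺⇒⊑ (inj₂ (_ , s∈ , c⊑s)) = deeper s∈ c⊑s

    codeQ : QuasiEmbedding Y Y⁺
    codeQ = record
      { func = record { to = code ; cong = code-cong }
      ; cancel = λ p → ⊑⇒≤ (≤⁺⇒⊑ p)
      }

    codeQ-embedding : IsEmbedding codeQ
    codeQ-embedding x≤y = ⊑⇒≤⁺ (≤⇒⊑ x≤y)

    codeFunc⁺ : Y⁺ ⟶ F₀ Y⁺
    codeFunc⁺ = record { to = to (F₁ codeQ) ; cong = to-cong (F₁ codeQ) }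

    code⁺ : ∣ F₀ Y ∣ → ∣ F₀ Y⁺ ∣
    code⁺ = to (F₁ codeQ)

    _⊑⁺_ : ∣ F₀ Y⁺ ∣ → ∣ Y⁺ ∣ → Set ℓ
    _⊑⁺_ = Under Y⁺ codeFunc⁺

    ⊑⇒⊑⁺ : ∀ {c t} → c ⊑ t → code⁺ c ⊑⁺ code t
    ⊑⇒⊑⁺ (direct c≤) = direct (F₁-embedding codeQ codeQ-embedding c≤)
    ⊑⇒⊑⁺ (deeper s∈ c⊑s) = deeper (∈-supp-map⁺ codeQ s∈) (⊑⇒⊑⁺ c⊑s)

    -- The induction needs a target `d` equal to `code t` only up to `≈`, as members of the support
    -- of `code⁺ d` are images under `code` only in this sense.
    ⊑⁺⇒⊑ : ∀ {c d t} → code⁺ c ⊑⁺ d → d V.≈ code t → c ⊑ t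
    ⊑⁺⇒⊑ (direct c≤) d≈ = direct (V.trans (cancel (F₁ codeQ) c≤) (V.reflexive d≈))
    ⊑⁺⇒⊑ (deeper s∈ c⊑s) d≈ with ∈-supp-map⁻ codeQ s∈
    ... | s′ , s′∈d , code-s′≈s = deeper (supp-cong d≈ s′∈d) (⊑⁺⇒⊑ c⊑s (V.Eq.sym code-s′≈s))

    ≤⁺⇒⊑⁺ : ∀ {c d} → c ≤⁺ d → code⁺ c ⊑⁺ d
    ≤⁺⇒⊑⁺ (inj₁ c≤d) = direct (F₁-embedding codeQ codeQ-embedding c≤d)
    ≤⁺⇒⊑⁺ (inj₂ (s , s∈d , c⊑s)) = deeper (∈-supp-map⁺ codeQ s∈d) (⊑⇒⊑⁺ c⊑s)

    ⊑⁺⇒≤⁺ : ∀ {c d} → code⁺ c ⊑⁺ d → c ≤⁺ d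
    ⊑⁺⇒≤⁺ (direct c≤) = inj₁ (cancel (F₁ codeQ) c≤)
    ⊑⁺⇒≤⁺ (deeper s∈ c⊑s) with ∈-supp-map⁻ codeQ s∈
    ... | s′ , s′∈d , code-s′≈s = inj₂ (s′ , s′∈d , ⊑⁺⇒⊑ c⊑s (V.Eq.sym code-s′≈s))

    -- By naturality the support of `code⁺ c` is the image of `supp c` under `code`, and `rank-code`
    -- says that `code` turns heights into equal ranks.
    rank-code⁺ : ∀ c → ℕ.suc (sup Y⁺ rank ≤⁺-rank (supp Y⁺ (code⁺ c))) ≡ rank c
    rank-code⁺ c = ≡.cong ℕ.suc (ℕ.≤-antisym
      (sup≤ Y⁺ rank ≤⁺-rank (supp Y⁺ (code⁺ c)) λ s∈ →
        let s′ , s′∈c , code-s′≈s = ∈-supp-map⁻ codeQ s∈ in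
        ℕ.≤-trans (rank-mono (V.reflexive (V.Eq.sym code-s′≈s)))
          (ℕ.≤-trans (ℕ.≤-reflexive (rank-code s′)) (≤sup Y height height-mono s′∈c)))
      (sup≤ Y height height-mono (supp Y c) λ {s} s∈c →
        ℕ.≤-trans (ℕ.≤-reflexive (≡.sym (rank-code s))) (≤sup Y⁺ rank ≤⁺-rank (∈-supp-map⁺ codeQ s∈c))))

    next : Stage
    next = record
      { Y = Y⁺
      ; codeFunc = codeFunc⁺
      ; ≤⇒⊑ = ≤⁺⇒⊑⁺
      ; ⊑⇒≤ = ⊑⁺⇒≤⁺
      ; height = rank
      ; height-mono = ≤⁺-rank
      ; rank-code = rank-code⁺
      }

  stage : ℕ → Stage
  stage ℕ.zero = record
    { Y = record
      { Carrier = Lift ℓ ⊥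
      ; _≈_ = λ ()
      ; _≤_ = λ ()
      ; isPartialOrder = record
        { isPreorder = record
          { isEquivalence = record { refl = λ {} ; sym = λ {} ; trans = λ {} }
          ; reflexive = λ {}
          ; trans = λ {}
          }
        ; antisym = λ {}
        }
      }
    ; codeFunc = record { to = λ () ; cong = λ {} }
    ; ≤⇒⊑ = λ {}
    ; ⊑⇒≤ = λ {}
    ; height = λ ()
    ; height-mono = λ {}
    ; rank-code = λ ()
    }
  stage (ℕ.suc n) = Next.next (stage n)

-- Colimits of chains of partial orders.

module Chain (Y : ℕ → PartialOrder ℓ) (e : ∀ n → QuasiEmbedding (Y n) (Y (ℕ.suc n))) where
  private
    module Y n = Poset (Y n)

  push : ∀ {m n} → m ≤′ n → QuasiEmbedding (Y m) (Y n)
  push ≤′-refl = idQ _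
  push (≤′-step p) = e _ ∘Q push p

  record Colimit : Set (suc ℓ) where
    field
      limit       : PartialOrder ℓ
      inj         : ∀ n → QuasiEmbedding (Y n) limit
      inj-emb     : ∀ n → IsEmbedding (inj n)
    open Poset limit using (_≈_; module Eq)
    field
      inj-e       : ∀ n y → to (inj (ℕ.suc n)) (to (e n) y) ≈ to (inj n) y
      inj-covers  : ∀ z → ∃[ n ] ∃[ y ] to (inj n) y ≈ z
      copair      : (h : ∀ n → ∣ Y n ∣ → ℕ) → (∀ n {x y} → Y._≈_ n x y → h n x ≡ h n y) →
                    (∀ n y → h (ℕ.suc n) (to (e n) y) ≡ h n y) →
                    Σ[ k ∈ Func Eq.setoid (setoid ℕ) ] (∀ n y → Func.to k (to (inj n) y) ≡ h n y)

    inj-push : ∀ {m n} (p : m ≤′ n) y → to (inj n) (to (push p) y) ≈ to (inj m) y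
    inj-push ≤′-refl y = Eq.refl
    inj-push (≤′-step p) y = Eq.trans (inj-e _ (to (push p) y)) (inj-push p y)

    -- Take the maximum of the stages at which the members occur. With `supp-range` this places each
    -- element of `F₀ limit` over a single stage.
    finite-support : (a : List ∣ limit ∣) →
                     ∃[ N ] (∀ {z} → z ∈[ limit ] a → ∃[ y ] to (inj N) y ≈ z)
    finite-support [] = 0 , λ ()
    finite-support (w ∷ a) with inj-covers w | finite-support a
    ... | m , x , x≈w | n , in-n = m ⊔ n , λ
      { (here z≈w) → to (push m≤) x , Eq.trans (inj-push m≤ x) (Eq.trans x≈w (Eq.sym z≈w))
      ; (there z∈a) → let y , y≈z = in-n z∈a in to (push n≤) y , Eq.trans (inj-push n≤ y) y≈z
      }
      where
      m≤ = ℕ.≤⇒≤′ (ℕ.m≤m⊔n m n)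
      n≤ = ℕ.≤⇒≤′ (ℕ.m≤n⊔m m n)

  module _ (e-emb : ∀ n → IsEmbedding (e n)) where

    push-emb : ∀ {m n} (p : m ≤′ n) → IsEmbedding (push p)
    push-emb ≤′-refl = λ x≤y → x≤y
    push-emb (≤′-step p) x≤y = e-emb _ (push-emb p x≤y)

    push-irrelevant : ∀ {m n} (p q : m ≤′ n) → push p ≗ push q
    push-irrelevant ≤′-refl ≤′-refl x = Y.Eq.refl _
    push-irrelevant ≤′-refl (≤′-step q) x = contradiction (ℕ.≤′⇒≤ q) ℕ.1+n≰n
    push-irrelevant (≤′-step p) ≤′-refl x = contradiction (ℕ.≤′⇒≤ p) ℕ.1+n≰n
    push-irrelevant (≤′-step p) (≤′-step q) x = to-cong (e _) (push-irrelevant p q x)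

    push-trans : ∀ {l m n} (p : l ≤′ m) (q : m ≤′ n) → push (ℕ.≤′-trans p q) ≗ push q ∘Q push p
    push-trans p ≤′-refl x = Y.Eq.refl _
    push-trans p (≤′-step q) x = to-cong (e _) (push-trans p q x)

    Point : Set ℓ
    Point = Σ[ n ∈ ℕ ] ∣ Y n ∣

    infix 4 _≤∞_
    _≤∞_ : Point → Point → Set ℓ
    (m , x) ≤∞ (n , y) = ∃[ N ] Σ[ p ∈ m ≤′ N ] Σ[ q ∈ n ≤′ N ] Y._≤_ N (to (push p) x) (to (push q) y)

    -- A comparison at one stage holds at every common stage: the embeddings carry it from `M` up to
    -- `M ⊔ N`, and it is reflected down to `N`.
    ≤∞⇒≤ : ∀ {m n x y} → (m , x) ≤∞ (n , y) → ∀ {N} (p : m ≤′ N) (q : n ≤′ N) →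
           Y._≤_ N (to (push p) x) (to (push q) y)
    ≤∞⇒≤ {m} {n} {x} {y} (M , p′ , q′ , x≤y) {N} p q = cancel (push N≤K)
      (≈-from-≤ (Y K) (path p′ p x) (path q′ q y) (push-emb M≤K x≤y))
      where
      K = M ⊔ N
      M≤K : M ≤′ K
      M≤K = ℕ.≤⇒≤′ (ℕ.m≤m⊔n M N)
      N≤K : N ≤′ K
      N≤K = ℕ.≤⇒≤′ (ℕ.m≤n⊔m M N)
      path : ∀ {l} (r : l ≤′ M) (s : l ≤′ N) (z : ∣ Y l ∣) →
             Y._≈_ K (to (push M≤K) (to (push r) z)) (to (push N≤K) (to (push s) z))
      path r s z = Y.Eq.trans K (Y.Eq.sym K (push-trans r M≤K z))
        (Y.Eq.trans K (push-irrelevant (ℕ.≤′-trans r M≤K) (ℕ.≤′-trans s N≤K) z) (push-trans s N≤K z))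

    ≤∞-refl : ∀ {a} → a ≤∞ a
    ≤∞-refl {n , _} = n , ≤′-refl , ≤′-refl , Y.refl n

    ≤∞-trans : ∀ {a b c} → a ≤∞ b → b ≤∞ c → a ≤∞ c
    ≤∞-trans {l , _} {m , _} {n , _} a≤b b≤c =
      N , l≤N , n≤N , Y.trans N (≤∞⇒≤ a≤b l≤N m≤N) (≤∞⇒≤ b≤c m≤N n≤N)
      where
      N = (l ⊔ m) ⊔ n
      l≤N = ℕ.≤⇒≤′ (ℕ.m≤n⇒m≤n⊔o n (ℕ.m≤m⊔n l m))
      m≤N = ℕ.≤⇒≤′ (ℕ.m≤n⇒m≤n⊔o n (ℕ.m≤n⊔m l m))
      n≤N = ℕ.≤⇒≤′ (ℕ.m≤n⊔m (l ⊔ m) n)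

    colimit : Colimit
    colimit = record
      { limit = record
        { Carrier = Point
        ; _≈_ = λ a b → a ≤∞ b × b ≤∞ a
        ; _≤_ = _≤∞_
        ; isPartialOrder = record
          { isPreorder = record
            { isEquivalence = record
              { refl = ≤∞-refl , ≤∞-refl
              ; sym = λ (p , q) → q , p
              ; trans = λ (p , q) (r , s) → ≤∞-trans p r , ≤∞-trans s q
              }
            ; reflexive = proj₁
            ; trans = ≤∞-trans
            }
          ; antisym = _,_
          }
        }
      ; inj = λ n → record
        { func = record
          { to = n ,_
          ; cong = λ x≈y → (n , ≤′-refl , ≤′-refl , Y.reflexive n x≈y)
                         , (n , ≤′-refl , ≤′-refl , Y.reflexive n (Y.Eq.sym n x≈y))
          }
        ; cancel = λ x≤y → ≤∞⇒≤ x≤y ≤′-refl ≤′-refl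
        }
      ; inj-emb = λ n x≤y → n , ≤′-refl , ≤′-refl , x≤y
      ; inj-e = λ n y → (_ , ≤′-refl , ≤′-step ≤′-refl , Y.refl _)
                      , (_ , ≤′-step ≤′-refl , ≤′-refl , Y.refl _)
      ; inj-covers = λ (n , y) → n , y , (≤∞-refl , ≤∞-refl)
      ; copair = λ h h-cong h-e → record
        { to = λ (n , y) → h n y
        ; cong = λ {a} {b} a≈b → copair-cong h h-cong h-e a b a≈b
        } , λ n y → ≡.refl
      }
      where
      module _ (h : ∀ n → ∣ Y n ∣ → ℕ) (h-cong : ∀ n {x y} → Y._≈_ n x y → h n x ≡ h n y)
               (h-e : ∀ n y → h (ℕ.suc n) (to (e n) y) ≡ h n y) where
        h-push : ∀ {m n} (p : m ≤′ n) y → h n (to (push p) y) ≡ h m y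
        h-push ≤′-refl y = ≡.refl
        h-push (≤′-step p) y = ≡.trans (h-e _ (to (push p) y)) (h-push p y)

        copair-cong : ∀ a b → a ≤∞ b × b ≤∞ a → h (proj₁ a) (proj₂ a) ≡ h (proj₁ b) (proj₂ b)
        copair-cong (m , x) (n , y) ((N , p , q , x≤y) , y≤x) =
          ≡.trans (≡.sym (h-push p x))
            (≡.trans (h-cong N (Y.antisym N x≤y (≤∞⇒≤ y≤x q p))) (h-push q y))

-- The generated algebra on the colimit of the stages.

module FixedPoint (W : PODilator ℓ) (normal : Normal W) where
  open PODilator W
  open Dilator W
  open Construction W normal
  private
    module S n = Stage (stage n)
    module N n = Next (stage n)
  open Chain S.Y N.codeQ

  module _ (L : Colimit) where
    open Colimit L
    private
      module Z = Poset limit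
      module F₀Z = Poset (F₀ limit)

    Represents : ∀ n → ∣ F₀ (S.Y n) ∣ → ∣ F₀ limit ∣ → Set ℓ
    Represents n c₀ c = to (F₁ (inj n)) c₀ F₀Z.≈ c

    represent : ∀ c → ∃[ n ] ∃[ c₀ ] Represents n c₀ c
    represent c with finite-support (supp limit c)
    ... | n , in-n = n , proj₂ (supp-range (inj n) (inj-emb n)) in-n

    Represents-injective : ∀ {n c₀ d₀ c} → Represents n c₀ c → Represents n d₀ c →
                           Poset._≈_ (F₀ (S.Y n)) c₀ d₀
    Represents-injective {n} r s = cancel-≈ (F₁ (inj n)) (F₀Z.Eq.trans r (F₀Z.Eq.sym s))

    -- Codes over stage `n` are by definition the elements of stage `n + 1`, so they are injected
    -- directly.
    κ₀ : ∀ n → ∣ F₀ (S.Y n) ∣ → ∣ limit ∣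
    κ₀ n = to (inj (ℕ.suc n))

    -- The transition map out of stage `n + 1` is `F₁` of the one out of stage `n`, so moving a code
    -- along `F₁ (push p)` stays within its class in the colimit.
    κ₀-push : ∀ {m n} (p : m ≤′ n) c → κ₀ n (to (F₁ (push p)) c) Z.≈ κ₀ m c
    κ₀-push {m} ≤′-refl c = to-cong (inj (ℕ.suc m)) (identity c)
    κ₀-push {m} {ℕ.suc n} (≤′-step p) c = Z.Eq.trans
      (to-cong (inj (ℕ.suc (ℕ.suc n))) (homomorphism (push p) (N.codeQ n) c))
      (Z.Eq.trans (inj-e (ℕ.suc n) (to (F₁ (push p)) c)) (κ₀-push p c))

    Represents-push : ∀ {m n c₀ c} (p : m ≤′ n) → Represents m c₀ c → Represents n (to (F₁ (push p)) c₀) c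
    Represents-push {m} {n} {c₀} p r =
      F₀Z.Eq.trans (F₁-∘ {f = push p} {g = inj n} {h = inj m} (inj-push p) c₀) r

    -- At stage `m ⊔ n` both representatives have the image `c` under the injective map
    -- `F₁ (inj (m ⊔ n))`.
    κ₀-unique : ∀ {m n c₁ c₂ c} → Represents m c₁ c → Represents n c₂ c → κ₀ m c₁ Z.≈ κ₀ n c₂
    κ₀-unique {m} {n} {c₁} {c₂} r₁ r₂ = Z.Eq.trans (Z.Eq.sym (κ₀-push m≤ c₁))
      (Z.Eq.trans (to-cong (inj (ℕ.suc (m ⊔ n)))
        (Represents-injective (Represents-push m≤ r₁) (Represents-push n≤ r₂))) (κ₀-push n≤ c₂))
      where
      m≤ = ℕ.≤⇒≤′ (ℕ.m≤m⊔n m n)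
      n≤ = ℕ.≤⇒≤′ (ℕ.m≤n⊔m m n)

    κ : ∣ F₀ limit ∣ → ∣ limit ∣
    κ c = let n , c₀ , _ = represent c in κ₀ n c₀

    κ-represents : ∀ {n c₀ c} → Represents n c₀ c → κ c Z.≈ κ₀ n c₀
    κ-represents {c = c} = κ₀-unique (proj₂ (proj₂ (represent c)))

    represent₂ : ∀ c d → ∃[ n ] ∃[ c₀ ] ∃[ d₀ ] Represents n c₀ c × Represents n d₀ d
    represent₂ c d with represent c | represent d
    ... | m , c₀ , r | n , d₀ , s = m ⊔ n , _ , _ ,
      Represents-push (ℕ.≤⇒≤′ (ℕ.m≤m⊔n m n)) r , Represents-push (ℕ.≤⇒≤′ (ℕ.m≤n⊔m m n)) s

    κFunc : F₀ limit ⟶ limit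
    κFunc = record
      { to = κ
      ; cong = λ {c} {d} c≈d → let n , c₀ , r = represent c in
          Z.Eq.trans (κ-represents r) (Z.Eq.sym (κ-represents (F₀Z.Eq.trans r c≈d)))
      }

    κ-mono : ∀ {c d} → c F₀Z.≤ d → κ c Z.≤ κ d
    κ-mono {c} {d} c≤d with represent₂ c d
    ... | n , c₀ , d₀ , r , s = ≈-from-≤ limit (Z.Eq.sym (κ-represents r)) (Z.Eq.sym (κ-represents s))
      (inj-emb (ℕ.suc n) (inj₁ (cancel (F₁ (inj n)) (≈-from-≤ (F₀ limit) (F₀Z.Eq.sym r) (F₀Z.Eq.sym s) c≤d))))

    ≤κ : ∀ {c d s} → s ∈[ limit ] supp limit d → κ c Z.≤ s → κ c Z.≤ κ d
    ≤κ {c} {d} {s} s∈d κc≤s with represent₂ c d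
    ... | n , c₀ , d₀ , r , q with ∈-supp-map⁻ (inj n) (supp-cong (F₀Z.Eq.sym q) s∈d)
    ...   | y , y∈ , y≈s = ≈-from-≤ limit (Z.Eq.sym (κ-represents r)) (Z.Eq.sym (κ-represents q))
      -- In the colimit `s` is `y`, hence also `code y` one stage later. So `κ c ≤ s` becomes
      -- `c₀ ≤⁺ code y`, which amounts to `c₀ ⊑ y`.
      (inj-emb (ℕ.suc n) (inj₂ (y , y∈ , N.≤⁺⇒⊑ n (cancel (inj (ℕ.suc n))
        (≈-from-≤ limit (κ-represents r) (Z.Eq.trans (Z.Eq.sym y≈s) (Z.Eq.sym (inj-e n y))) κc≤s)))))

    κ≤κ⁻ : ∀ c d → κ c Z.≤ κ d → c F₀Z.≤ d ⊎ ∃[ s ] s ∈[ limit ] supp limit d × κ c Z.≤ s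
    κ≤κ⁻ c d κc≤κd with represent₂ c d
    ... | n , c₀ , d₀ , r , q
      with cancel (inj (ℕ.suc n)) (≈-from-≤ limit (κ-represents r) (κ-represents q) κc≤κd)
    ...   | inj₁ c₀≤d₀ = inj₁ (≈-from-≤ (F₀ limit) r q (F₁-embedding (inj n) (inj-emb n) c₀≤d₀))
    ...   | inj₂ (y , y∈ , c₀⊑y) = inj₂ (to (inj n) y , supp-cong q (∈-supp-map⁺ (inj n) y∈)
      , ≈-from-≤ limit (Z.Eq.sym (κ-represents r)) (inj-e n y) (inj-emb (ℕ.suc n) (N.⊑⇒≤⁺ n c₀⊑y)))

    -- The colimit identifies `y` at stage `n` with `code y` at stage `n + 1`, and the latter is a
    -- value of `κ`.
    κ-surjective : ∀ z → ∃[ c ] κ c Z.≈ z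
    κ-surjective z with inj-covers z
    ... | n , y , y≈z = to (F₁ (inj n)) (S.code n y)
      , Z.Eq.trans (κ-represents F₀Z.Eq.refl) (Z.Eq.trans (inj-e n y) y≈z)

    -- The height at stage `n + 1` is the rank of a code, so `rank-code` is exactly compatibility
    -- with the transition maps.
    heights = copair S.height
      (λ n x≈y → ℕ.≤-antisym (S.height-mono n (S.reflexive n x≈y))
                             (S.height-mono n (S.reflexive n (S.Eq.sym n x≈y))))
      S.rank-code

    heightFunc : Func Z.Eq.setoid (setoid ℕ)
    heightFunc = proj₁ heights
    open Func heightFunc using () renaming (to to height; cong to height-cong)

    height-inj : ∀ n y → height (to (inj n) y) ≡ S.height n y
    height-inj = proj₂ heights

    height-< : ∀ {s c} → s ∈[ limit ] supp limit c → height s < height (κ c)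
    height-< {s} {c} s∈c with represent c
    ... | n , c₀ , r with ∈-supp-map⁻ (inj n) (supp-cong (F₀Z.Eq.sym r) s∈c)
    ...   | y , y∈ , y≈s = ≡.subst₂ _<_
      (≡.trans (≡.sym (height-inj n y)) (height-cong y≈s))
      (≡.sym (≡.trans (height-cong (κ-represents r)) (height-inj (ℕ.suc n) c₀)))
      (N.height<rank n y∈)

    algebra : Algebra
    algebra = record { Z = limit ; κFunc = κFunc ; κ≤κ⁻ = κ≤κ⁻ }

    generated : Generated algebra
    generated = record
      { κ-surjective = κ-surjective
      ; κ-mono = κ-mono
      ; ≤κ = ≤κ
      ; rankFunc = heightFunc
      ; rank-< = height-<
      }

module _ (W : PODilator ℓ) (normal : Normal W) where
  open Dilator W
  open Construction W normal

  ∃-generated : Σ[ A ∈ Algebra ] Generated A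
  ∃-generated = FixedPoint.algebra W normal L , FixedPoint.generated W normal L
    where
    L = Chain.colimit (λ n → Stage.Y (stage n)) (λ n → Next.codeQ (stage n))
                      (λ n → Next.codeQ-embedding (stage n))

-- Adjoining the units, and both directions of the equivalence.

module Join (W : PODilator ℓ) (X : PartialOrder ℓ) where
  open PODilator W
  private
    module W = Dilator W

  -- With empty supports for units and a disjoint sum of orders, the mixed cases of the one
  -- condition on algebras become the clauses `ι≤κ` and `κ≰ι`.
  joinSupp : ∀ Y → ∣ X ∣ ⊎ ∣ F₀ Y ∣ → List ∣ Y ∣
  joinSupp Y = Sum.[ (λ _ → []) , supp Y ]

  V₀ : PartialOrder ℓ → PartialOrder ℓ
  V₀ Y = Pointwise.⊎-poset X (F₀ Y)

  V : PODilator ℓ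
  V = record
    { F₀ = V₀
    ; F₁ = λ f → record
      { func = record
        { to = Sum.map₂ (to (F₁ f))
        ; cong = λ { (inj₁ p) → inj₁ p ; (inj₂ p) → inj₂ (to-cong (F₁ f) p) }
        }
      ; cancel = λ
        { {inj₁ _} {inj₁ _} (inj₁ p) → inj₁ p
        ; {inj₂ _} {inj₂ _} (inj₂ p) → inj₂ (cancel (F₁ f) p)
        }
      }
    ; F-resp-≗ = λ {X = A} {Y = B} {f} {g} f≗g → λ
      { (inj₁ x) → inj₁ (Poset.Eq.refl X)
      ; (inj₂ σ) → inj₂ (F-resp-≗ {f = f} {g = g} f≗g σ)
      }
    ; identity = λ
      { (inj₁ x) → inj₁ (Poset.Eq.refl X)
      ; (inj₂ σ) → inj₂ (identity σ)
      }
    ; homomorphism = λ f g → λ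
      { (inj₁ x) → inj₁ (Poset.Eq.refl X)
      ; (inj₂ σ) → inj₂ (homomorphism f g σ)
      }
    ; F₁-embedding = λ f e → λ
      { (inj₁ p) → inj₁ p
      ; (inj₂ p) → inj₂ (F₁-embedding f e p)
      }
    ; suppFunc = λ Y → record
      { to = joinSupp Y
      ; cong = λ { (inj₁ p) → (λ ()) , (λ ()) ; (inj₂ p) → Func.cong (suppFunc Y) p }
      }
    ; supp-natural = λ f → λ
      { (inj₁ x) → (λ ()) , (λ ())
      ; (inj₂ σ) → supp-natural f σ
      }
    ; supp-range = λ {A} {B} f e →
        (λ { {inj₁ _} _ → λ ()
           ; {inj₂ _} (inj₂ ρ , inj₂ p) → proj₁ (supp-range f e) (ρ , p)
           })
      , (λ { {inj₁ x} _ → inj₁ x , inj₁ (Poset.Eq.refl X)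
           ; {inj₂ σ} σ⊆ → let ρ , p = proj₂ (supp-range f e) {σ} σ⊆ in inj₂ ρ , inj₂ p
           })
    }

  normal : Normal W → Normal V
  normal normalW Y (inj₁ _) ()
  normal normalW Y (inj₂ σ≤τ) = normalW Y σ≤τ

  open Dilator V using (Algebra; Generated; module Recursion)

  module _ (Y : PartialOrder ℓ) (x : ∣ Y ∣) (a : List ∣ Y ∣) where

    Dominated : Set ℓ
    Dominated = ∃[ y ] y ∈[ Y ] a × Poset._≤_ Y x y

    ≤fin⇒dominated : [ x ] ≤fin[ Y ] a → Dominated
    ≤fin⇒dominated x≤a = x≤a (here (Poset.Eq.refl Y))

    dominated⇒≤fin : Dominated → [ x ] ≤fin[ Y ] a
    dominated⇒≤fin (y , y∈a , x≤y) (here z≈x) = y , y∈a , Poset.trans Y (Poset.reflexive Y z≈x) x≤y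

  module _ (K : KruskalFixedPoint W X) where
    open KruskalFixedPoint K
    open Poset Z using (_≤_; module Eq)

    toAlgebra : Algebra
    toAlgebra = record
      { Z = Z
      ; κFunc = record
        { to = Sum.[ ι , κ ]
        ; cong = λ { (inj₁ p) → Func.cong ιFunc p ; (inj₂ p) → Func.cong κFunc p }
        }
      ; κ≤κ⁻ = λ
        { (inj₁ x) (inj₁ y) p → inj₁ (inj₁ (ι≤ι x y p))
        ; (inj₁ x) (inj₂ τ) p → inj₂ (≤fin⇒dominated Z (ι x) (supp Z τ) (Equivalence.to (ι≤κ x τ) p))
        ; (inj₂ σ) (inj₁ y) p → contradiction p (κ≰ι σ y)
        ; (inj₂ σ) (inj₂ τ) → κ≤κ⇒ σ τ
        }
      }
      where
      κ≤κ⇒ : ∀ σ τ → κ σ ≤ κ τ → _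
      κ≤κ⇒ σ τ p with Equivalence.to (κ≤κ σ τ) p
      ... | inj₁ σ≤τ = inj₁ (inj₂ σ≤τ)
      ... | inj₂ q = inj₂ (≤fin⇒dominated Z (κ σ) (supp Z τ) q)

    Covered MonotoneUnits Ranked : Set ℓ
    Covered = Universal (rng ιFunc ∪ rng κFunc)
    MonotoneUnits = ∀ x y → Poset._≤_ X x y → ι x ≤ ι y
    Ranked = Σ[ h ∈ Func Eq.setoid (setoid ℕ) ]
      (∀ s σ → s ∈[ Z ] supp Z σ → Func.to h s < Func.to h (κ σ))

    toGenerated : Covered → MonotoneUnits → Ranked → Generated toAlgebra
    toGenerated covered ι-mono (h , h<) = record
      { κ-surjective = λ z → Sum.[ (λ (x , p) → inj₁ x , p) , (λ (σ , p) → inj₂ σ , p) ] (covered z)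
      ; κ-mono = λ
        { (inj₁ p) → ι-mono _ _ p
        ; (inj₂ p) → Equivalence.from (κ≤κ _ _) (inj₁ p)
        }
      ; ≤κ = λ
        { {_} {inj₁ _} ()
        ; {inj₁ x} {inj₂ τ} s∈ p → Equivalence.from (ι≤κ x τ) (dominated⇒≤fin Z _ (supp Z τ) (_ , s∈ , p))
        ; {inj₂ σ} {inj₂ τ} s∈ p → Equivalence.from (κ≤κ σ τ) (inj₂ (dominated⇒≤fin Z _ (supp Z τ) (_ , s∈ , p)))
        }
      ; rankFunc = h
      ; rank-< = λ { {_} {inj₁ _} () ; {s} {inj₂ σ} s∈ → h< s σ s∈ }
      }

  characterization⇒initial : (K : KruskalFixedPoint W X) →
    Covered K → MonotoneUnits K → Ranked K → Initial K
  characterization⇒initial K covered ι-mono ranked K′ =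
    rec , ((λ x → rec-morphism (inj₁ x)) , (λ σ → rec-morphism (inj₂ σ)))
        , λ {f} (fι , fκ) → rec-unique {f} Sum.[ fι , fκ ]
    where open Recursion (toAlgebra K) (toAlgebra K′) (toGenerated K covered ι-mono ranked)

  module _ {A : Algebra} (gen : Generated A) where
    open Algebra A
    open Generated gen

    fromGenerated : KruskalFixedPoint W X
    fromGenerated = record
      { Z = Z
      ; ιFunc = record { to = λ x → κ (inj₁ x) ; cong = λ p → κ-cong (inj₁ p) }
      ; κFunc = record { to = λ σ → κ (inj₂ σ) ; cong = λ p → κ-cong (inj₂ p) }
      ; disjoint = λ z ((x , ιx≈z) , (σ , κσ≈z)) →
          κ₂≰κ₁ σ x (reflexive (Eq.trans κσ≈z (Eq.sym ιx≈z)))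
      ; ι≤ι = λ x y p → ι-cancel (κ≤κ⁻ (inj₁ x) (inj₁ y) p)
      ; ι≤κ = λ x τ → mk⇔ (ι≤κ⇒ x τ) (ι≤κ⇐ x τ)
      ; κ≰ι = κ₂≰κ₁
      ; κ≤κ = λ σ τ → mk⇔ (κ≤κ⇒ σ τ) (κ≤κ⇐ σ τ)
      }
      where
      κ₂≰κ₁ : ∀ σ y → κ (inj₂ σ) ≤ κ (inj₁ y) → _
      κ₂≰κ₁ σ y p with κ≤κ⁻ (inj₂ σ) (inj₁ y) p
      ... | inj₁ ()
      ... | inj₂ (_ , () , _)
      ι-cancel : ∀ {x y} → _ ⊎ ∃[ s ] s ∈[ Z ] [] × κ (inj₁ x) ≤ s → Poset._≤_ X x y
      ι-cancel (inj₁ p) = Pointwise.drop-inj₁ p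
      ι≤κ⇒ : ∀ x τ → κ (inj₁ x) ≤ κ (inj₂ τ) → [ κ (inj₁ x) ] ≤fin[ Z ] supp Z τ
      ι≤κ⇒ x τ p with κ≤κ⁻ (inj₁ x) (inj₂ τ) p
      ... | inj₂ q = dominated⇒≤fin Z _ (supp Z τ) q
      ι≤κ⇐ : ∀ x τ → [ κ (inj₁ x) ] ≤fin[ Z ] supp Z τ → κ (inj₁ x) ≤ κ (inj₂ τ)
      ι≤κ⇐ x τ p with ≤fin⇒dominated Z (κ (inj₁ x)) (supp Z τ) p
      ... | s , s∈ , q = ≤κ {inj₁ x} {inj₂ τ} s∈ q
      κ≤κ⇒ : ∀ σ τ → κ (inj₂ σ) ≤ κ (inj₂ τ) →
             Poset._≤_ (F₀ Z) σ τ ⊎ [ κ (inj₂ σ) ] ≤fin[ Z ] supp Z τ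
      κ≤κ⇒ σ τ p with κ≤κ⁻ (inj₂ σ) (inj₂ τ) p
      ... | inj₁ (inj₂ σ≤τ) = inj₁ σ≤τ
      ... | inj₂ q = inj₂ (dominated⇒≤fin Z _ (supp Z τ) q)
      κ≤κ⇐ : ∀ σ τ → Poset._≤_ (F₀ Z) σ τ ⊎ [ κ (inj₂ σ) ] ≤fin[ Z ] supp Z τ →
             κ (inj₂ σ) ≤ κ (inj₂ τ)
      κ≤κ⇐ σ τ (inj₁ σ≤τ) = κ-mono (inj₂ σ≤τ)
      κ≤κ⇐ σ τ (inj₂ p) with ≤fin⇒dominated Z (κ (inj₂ σ)) (supp Z τ) p
      ... | s , s∈ , q = ≤κ {inj₂ σ} {inj₂ τ} s∈ q

    fromGenerated-covered : Covered fromGenerated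
    fromGenerated-covered z with κ-surjective z
    ... | inj₁ x , p = inj₁ (x , p)
    ... | inj₂ σ , p = inj₂ (σ , p)

    fromGenerated-monotone : MonotoneUnits fromGenerated
    fromGenerated-monotone x y p = κ-mono (inj₁ p)

    fromGenerated-ranked : Ranked fromGenerated
    fromGenerated-ranked = rankFunc , λ s σ s∈ → rank-< {s} {inj₂ σ} s∈

  initial⇒characterization : {A : Algebra} → Generated A → (K : KruskalFixedPoint W X) → Initial K →
    Covered K × MonotoneUnits K × Ranked K
  initial⇒characterization generated K initial = covered , ι-mono , ranked
    where
    K₀ : KruskalFixedPoint W X
    K₀ = fromGenerated generated
    module K = KruskalFixedPoint K
    module K₀ = KruskalFixedPoint K₀
    module Z = Poset K.Z
    module Z₀ = Poset K₀.Z

    f : QuasiEmbedding K.Z K₀.Z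
    f = proj₁ (initial K₀)
    fι = proj₁ (proj₁ (proj₂ (initial K₀)))
    fκ = proj₂ (proj₁ (proj₂ (initial K₀)))

    initial₀ : ∃! _≗_ (IsMorphism K₀ K)
    initial₀ = characterization⇒initial K₀ (fromGenerated-covered generated)
      (fromGenerated-monotone generated) (fromGenerated-ranked generated) K
    g : QuasiEmbedding K₀.Z K.Z
    g = proj₁ initial₀
    gι = proj₁ (proj₁ (proj₂ initial₀))
    gκ = proj₂ (proj₁ (proj₂ initial₀))

    -- The composite and the identity are both morphisms from `K` to `K`, so uniqueness identifies
    -- them.
    gf≗id : ∀ z → to g (to f z) Z.≈ z
    gf≗id z = Z.Eq.trans (Z.Eq.sym (unique {g ∘Q f} gf-morphism z)) (unique {idQ K.Z} id-morphism z)
      where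
      unique : ∀ {h} → IsMorphism K K h → proj₁ (initial K) ≗ h
      unique = proj₂ (proj₂ (initial K))
      gf-morphism : IsMorphism K K (g ∘Q f)
      gf-morphism =
        (λ x → Z.Eq.trans (to-cong g (fι x)) (gι x)) ,
        (λ σ → Z.Eq.trans (to-cong g (fκ σ)) (Z.Eq.trans (gκ (to (F₁ f) σ))
          (Func.cong K.κFunc (Poset.Eq.sym (F₀ K.Z) (homomorphism f g σ)))))
      id-morphism : IsMorphism K K (idQ K.Z)
      id-morphism = (λ x → Z.Eq.refl) ,
        (λ σ → Func.cong K.κFunc (Poset.Eq.sym (F₀ K.Z) (identity σ)))

    covered : Covered K
    covered z with fromGenerated-covered generated (to f z)
    ... | inj₁ (x , ιx≈fz) = inj₁ (x , Z.Eq.trans (Z.Eq.sym (gι x)) (Z.Eq.trans (to-cong g ιx≈fz) (gf≗id z)))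
    ... | inj₂ (σ , κσ≈fz) =
      inj₂ (to (F₁ g) σ , Z.Eq.trans (Z.Eq.sym (gκ σ)) (Z.Eq.trans (to-cong g κσ≈fz) (gf≗id z)))

    ι-mono : MonotoneUnits K
    -- `f` reflects the order and sends the units of `K` to those of `K₀`, which are monotone.
    ι-mono x y x≤y = cancel f (≈-from-≤ K₀.Z (Z₀.Eq.sym (fι x)) (Z₀.Eq.sym (fι y))
      (fromGenerated-monotone generated x y x≤y))

    ranked : Ranked K
    ranked with fromGenerated-ranked generated
    -- The rank is pulled back along `f`, which maps supports into supports by naturality.
    ... | h , h< = record { to = λ z → Func.to h (to f z) ; cong = λ p → Func.cong h (to-cong f p) }
      , λ s σ s∈ → ≡.subst (Func.to h (to f s) <_) (≡.sym (Func.cong h (fκ σ)))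
          (h< (to f s) (to (F₁ f) σ) (W.∈-supp-map⁺ f s∈))

theorem3p5 : ∀ {ℓ : Level} (W : PODilator ℓ) → Normal W →
    (X : PartialOrder ℓ) (K : KruskalFixedPoint W X) →
    let open PODilator W
        open KruskalFixedPoint K
    in ( Universal (rng ιFunc ∪ rng κFunc)
       × (∀ x y → Poset._≤_ X x y → Poset._≤_ Z (ι x) (ι y))
       × (Σ[ h ∈ Func (Poset.Eq.setoid Z) (setoid ℕ) ]
            (∀ s σ → s ∈[ Z ] supp Z σ → Func.to h s < Func.to h (κ σ))) )
       ⇔ Initial K
theorem3p5 W normalW X K = mk⇔
  (λ (covered , ι-mono , ranked) → characterization⇒initial K covered ι-mono ranked)
  (initial⇒characterization (proj₂ (∃-generated V (normal normalW))) K)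
  where open Join W X
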